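{- Let $q=3^d$ with $d$ even, and let $\beta$ be a fixed primitive root of $\mathbb{F}_q^\times$ (a generator of the multiplicative group). Let $E\colon y^2=x^3+a_4x+a_6$ be an elliptic curve over $\mathbb{F}_q$ such that $-a_4\in\mathbb{F}_q^\times$ is not a square; equivalently $a_4\in\beta(\mathbb{F}_q^\times)^4\cup\beta^3(\mathbb{F}_q^\times)^4$. (a) If $a_4\in\beta(\mathbb{F}_q^\times)^4$ (Type IIIa), then $E$ is isomorphic over $\mathbb{F}_q$ to $y^2=x^3-\beta x$, and every elliptic curve $y^2=x^3+a_4'x+a_6'$ isomorphic to $E$ over $\mathbb{F}_q$ is also of Type IIIa. (b) If $a_4\in\beta^3(\mathbb{F}_q^\times)^4$ (Type IIIb), then $E$ is isomorphic over $\mathbb{F}_q$ to $y^2=x^3-\beta^3x$.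
   Context: $(\mathbb{F}_q^\times)^4$ denotes the subgroup of fourth powers in $\mathbb{F}_q^\times$. In characteristic $3$, every supersingular elliptic curve over $\mathbb{F}_q$ can be written as $y^2=x^3+a_4x+a_6$ with $a_4\neq0$. -}

module Defs where

open import Level using (Level; suc; _⊔_)
open import Data.Nat.Base using (ℕ)
open import Data.Fin.Base using (Fin)
open import Data.Product.Base using (_×_; ∃-syntax)
open import Relation.Nullary.Negation.Core using (¬_)
open import Relation.Binary.PropositionalEquality using (setoid)
open import Function.Bundles using (Inverse)
open import Algebra.Bundles using (CommutativeRing)
import Algebra.Definitions

record Field (c ℓ : Level) : Set (suc (c ⊔ ℓ)) where
  field
    commutativeRing : CommutativeRing c ℓ

  open CommutativeRing commutativeRing public
  open Algebra.Definitions _≈_ using (Invertible)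

  field
    1≉0        : ¬ (1# ≈ 0#)
    invertible : ∀ x → ¬ (x ≈ 0#) → Invertible 1# _*_ x

-- The field has exactly q elements up to its equality _≈_.
HasOrder : ∀ {c ℓ} → Field c ℓ → ℕ → Set (c ⊔ ℓ)
HasOrder K q = Inverse (setoid (Fin q)) (Field.setoid K)

module _ {c ℓ} (K : Field c ℓ) where

  open Field K
  open import Algebra.Properties.Semiring.Exp semiring using (_^_)
  open import Algebra.Properties.Semiring.Mult semiring
    using () renaming (_×_ to infixr 8 _•_)

  -- Since K is finite wherever this is used, nonnegative exponents suffice to
  -- express that β generates the group K^×.
  IsPrimitiveRoot : Carrier → Set (c ⊔ ℓ)
  IsPrimitiveRoot β =
    ¬ (β ≈ 0#) × (∀ x → ¬ (x ≈ 0#) → ∃[ k ] x ≈ β ^ k)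

  IsNonsquareUnit : Carrier → Set (c ⊔ ℓ)
  IsNonsquareUnit x = ¬ (x ≈ 0#) × ¬ (∃[ y ] x ≈ y ^ 2)

  -- a ∈ g (K^×)⁴
  InFourthPowerCoset : Carrier → Carrier → Set (c ⊔ ℓ)
  InFourthPowerCoset g a = ∃[ z ] ¬ (z ≈ 0#) × a ≈ g * z ^ 4

  -- The equation y² + a₁xy + a₃y = x³ + a₂x² + a₄x + a₆.
  record Weierstrass : Set c where
    constructor weierstrass
    field
      a₁ a₂ a₃ a₄ a₆ : Carrier

    b₂ b₄ b₆ b₈ Δ : Carrier
    b₂ = a₁ ^ 2 + 4 • a₂
    b₄ = 2 • a₄ + a₁ * a₃
    b₆ = a₃ ^ 2 + 4 • a₆
    b₈ = a₁ ^ 2 * a₆ + 4 • (a₂ * a₆) - a₁ * a₃ * a₄ + a₂ * a₃ ^ 2 - a₄ ^ 2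
    Δ  = 9 • (b₂ * b₄ * b₆) - b₂ ^ 2 * b₈ - 8 • (b₄ ^ 3) - 27 • (b₆ ^ 2)

  IsElliptic : Weierstrass → Set ℓ
  IsElliptic E = ¬ (Weierstrass.Δ E ≈ 0#)

  -- The equation y² = x³ + a₄x + a₆.
  short : Carrier → Carrier → Weierstrass
  short a₄ a₆ = weierstrass 0# 0# 0# a₄ a₆

  -- An isomorphism E → E′ over K of elliptic curves in Weierstrass form is an
  -- admissible change of variables with coefficients in K,
  --   x = u²x′ + r,   y = u³y′ + su²x′ + t,   u ≠ 0,
  -- carrying the equation of E to that of E′.  Substituting in E, dividing by
  -- u⁶ and comparing coefficients with E′ gives the five equations below.
  record Isomorphism (E E′ : Weierstrass) : Set (c ⊔ ℓ) where
    private
      module E  = Weierstrass E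
      module E′ = Weierstrass E′
    field
      u r s t : Carrier
      u≉0 : ¬ (u ≈ 0#)
      a₁-eq : u * E′.a₁ ≈ E.a₁ + 2 • s
      a₂-eq : u ^ 2 * E′.a₂ ≈ E.a₂ - s * E.a₁ + 3 • r - s ^ 2
      a₃-eq : u ^ 3 * E′.a₃ ≈ E.a₃ + r * E.a₁ + 2 • t
      a₄-eq : u ^ 4 * E′.a₄ ≈
        E.a₄ - s * E.a₃ + 2 • (r * E.a₂) - (t + r * s) * E.a₁
          + 3 • (r ^ 2) - 2 • (s * t)
      a₆-eq : u ^ 6 * E′.a₆ ≈
        E.a₆ + r * E.a₄ + r ^ 2 * E.a₂ + r ^ 3
          - t * E.a₃ - t ^ 2 - r * t * E.a₁

  TypeIIIa : Carrier → Carrier → Set (c ⊔ ℓ)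
  TypeIIIa β a₄ = InFourthPowerCoset β a₄

  TypeIIIb : Carrier → Carrier → Set (c ⊔ ℓ)
  TypeIIIb β a₄ = InFourthPowerCoset (β ^ 3) a₄

{-# OPTIONS --safe #-}

-- (1) 8 ∣ q − 1 and β has order q − 1, so −1 is a
-- fourth power w⁴ and odd powers of β are nonsquares; this gives the
-- description of the nonsquare −a₄ by cosets.  (2) K has characteristic 3, so
-- r ↦ r³ + a₄r is additive, with trivial kernel when −a₄ is not a square; being
-- injective on a finite set, it takes the value −a₆, and translating x by that
-- r removes a₆.  Scaling by u = zw then turns a₄ = gz⁴ into −g.  (3) In
-- characteristic 3 an isomorphism of short equations has s = 0 and therefore
-- multiplies a₄ by a fourth power.

module Submission where

open import Defs
open import Level using (Level)
open import Data.Nat.Base using (ℕ; _^_)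
open import Data.Nat.Divisibility using (_∣_)
open import Data.Product.Base using (_×_)
open import Data.Sum.Base using (_⊎_)
open import Function.Bundles using (_⇔_)
open import Algebra.Properties.Semiring.Exp using () renaming (_^_ to power)

open import Data.Nat.Base as ℕ using (zero; suc; s≤s; NonZero)
import Data.Nat.Properties as ℕ
open import Data.Nat.Divisibility
  using (divides; ∣m+n∣m⇒∣n; m∣m*n; ∣-trans; ∣1⇒≡1; m%n≡0⇒n∣m)
open import Data.Nat.DivMod using (_%_; _/_; m≡m%n+[m/n]*n; m%n<n)
import Data.Nat.Solver as ℕ
open import Data.Fin.Base as Fin using (Fin; zero; suc; toℕ; fromℕ<)
import Data.Fin.Properties as Fin
open import Data.Fin.Permutation using (Permutation; permutation)
open import Data.Product.Base using (_,_; ∃-syntax; proj₁; proj₂)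
open import Data.Sum.Base using (inj₁; inj₂; [_,_]′)
open import Data.Vec.Functional using (_∷_)
open import Function.Base using (_∘_)
open import Function.Bundles using (Inverse; mk⇔)
open import Relation.Nullary using (¬_; Dec; yes; no; contradiction)
open import Relation.Nullary.Decidable using (map′)
open import Relation.Binary.PropositionalEquality as ≡ using (_≡_)

-- Cancellation and powers in a field.

module FieldProperties {c ℓ : Level} (K : Field c ℓ) where

  open Field K hiding (zero)
  open import Relation.Binary.Reasoning.Setoid setoid
  open import Algebra.Properties.Semiring.Exp semiring
    using (^-congˡ; ^-homo-*; ^-assocʳ) renaming (_^_ to infixr 8 _↑_)

  *-cancelˡ : ∀ {x y z} → ¬ (x ≈ 0#) → x * y ≈ x * z → y ≈ z
  *-cancelˡ {x} {y} {z} x≉0 xy≈xz with invertible x x≉0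
  ... | x⁻¹ , x⁻¹x≈1 , _ = trans (sym (undo y)) (trans (*-congˡ xy≈xz) (undo z))
    where
    undo : ∀ t → x⁻¹ * (x * t) ≈ t
    undo t = trans (sym (*-assoc _ _ _)) (trans (*-congʳ x⁻¹x≈1) (*-identityˡ t))

  *-cancel-0 : ∀ {x y} → ¬ (x ≈ 0#) → x * y ≈ 0# → y ≈ 0#
  *-cancel-0 x≉0 xy≈0 = *-cancelˡ x≉0 (trans xy≈0 (sym (zeroʳ _)))

  *-nonzero : ∀ {x y} → ¬ (x ≈ 0#) → ¬ (y ≈ 0#) → ¬ (x * y ≈ 0#)
  *-nonzero x≉0 y≉0 = y≉0 ∘ *-cancel-0 x≉0

  ^-nonzero : ∀ {x} n → ¬ (x ≈ 0#) → ¬ (x ↑ n ≈ 0#)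
  ^-nonzero zero    x≉0 = 1≉0
  ^-nonzero (suc n) x≉0 = *-nonzero x≉0 (^-nonzero n x≉0)

  inverse-nonzero : ∀ {x y} → x * y ≈ 1# → ¬ (y ≈ 0#)
  inverse-nonzero xy≈1 y≈0 =
    1≉0 (trans (sym xy≈1) (trans (*-congˡ y≈0) (zeroʳ _)))

  ^-cancel : ∀ {x m n} → ¬ (x ≈ 0#) → m ℕ.≤ n → x ↑ m ≈ x ↑ n → x ↑ (n ℕ.∸ m) ≈ 1#
  ^-cancel {x} {m} {n} x≉0 m≤n eq = *-cancelˡ (^-nonzero m x≉0) (begin
    x ↑ m * x ↑ (n ℕ.∸ m)  ≈⟨ ^-homo-* x m (n ℕ.∸ m) ⟨
    x ↑ (m ℕ.+ (n ℕ.∸ m))  ≡⟨ ≡.cong (x ↑_) (ℕ.m+[n∸m]≡n m≤n) ⟩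
    x ↑ n                  ≈⟨ eq ⟨
    x ↑ m                  ≈⟨ *-identityʳ _ ⟨
    x ↑ m * 1#             ∎)

  1^n≈1 : ∀ n → 1# ↑ n ≈ 1#
  1^n≈1 zero    = refl
  1^n≈1 (suc n) = trans (*-identityˡ _) (1^n≈1 n)

  ^-period : ∀ {x n} → x ↑ n ≈ 1# → ∀ k → x ↑ (k ℕ.* n) ≈ 1#
  ^-period {x} {n} xⁿ≈1 k = begin
    x ↑ (k ℕ.* n)  ≡⟨ ≡.cong (x ↑_) (ℕ.*-comm k n) ⟩
    x ↑ (n ℕ.* k)  ≈⟨ ^-assocʳ x n k ⟨
    (x ↑ n) ↑ k    ≈⟨ ^-congˡ k xⁿ≈1 ⟩
    1# ↑ k         ≈⟨ 1^n≈1 k ⟩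
    1#             ∎

  ^-% : ∀ {x n} .{{_ : NonZero n}} → x ↑ n ≈ 1# → ∀ k → x ↑ (k % n) ≈ x ↑ k
  ^-% {x} {n} xⁿ≈1 k = begin
    x ↑ (k % n)                          ≈⟨ *-identityʳ _ ⟨
    x ↑ (k % n) * 1#                     ≈⟨ *-congˡ (^-period xⁿ≈1 (k / n)) ⟨
    x ↑ (k % n) * x ↑ (k / n ℕ.* n)      ≈⟨ ^-homo-* x (k % n) _ ⟨
    x ↑ (k % n ℕ.+ k / n ℕ.* n)          ≡⟨ ≡.cong (x ↑_) (m≡m%n+[m/n]*n k n) ⟨
    x ↑ k                                ∎

-- Counting in a finite field.

module FiniteField {c ℓ : Level} (K : Field c ℓ) {q : ℕ} (order : HasOrder K q) where

  open Field K hiding (zero)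
  open FieldProperties K
  open Inverse order
    using (to; from; from-cong; strictlyInverseˡ; strictlyInverseʳ)
  open import Relation.Binary.Reasoning.Setoid setoid
  open import Algebra.Properties.Group +-group using (∙-cancelˡ)
  open import Algebra.Properties.CommutativeMonoid.Sum +-commutativeMonoid
    using (sum; sum-permute; sum-cong-≋; ∑-distrib-+; sum-replicate)
  open import Algebra.Properties.Semiring.Mult semiring
    using () renaming (_×_ to infixr 8 _•_)

  from-injective : ∀ {x y} → from x ≡ from y → x ≈ y
  from-injective {x} {y} eq = begin
    x            ≈⟨ strictlyInverseˡ x ⟨
    to (from x)  ≡⟨ ≡.cong to eq ⟩
    to (from y)  ≈⟨ strictlyInverseˡ y ⟩
    y            ∎

  to-injective : ∀ {i j} → to i ≈ to j → i ≡ j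
  to-injective {i} {j} eq =
    ≡.trans (≡.sym (strictlyInverseʳ i)) (≡.trans (from-cong eq) (strictlyInverseʳ j))

  infix 4 _≈?_
  _≈?_ : ∀ x y → Dec (x ≈ y)
  x ≈? y = map′ from-injective from-cong (from x Fin.≟ from y)

  collision : (f : Fin (suc q) → Carrier) → ∃[ i ] ∃[ j ] i Fin.< j × f i ≈ f j
  collision f with Fin.pigeonhole (ℕ.n<1+n q) (from ∘ f)
  ... | i , j , i<j , eq = i , j , i<j , from-injective eq

  -- Pigeonhole on the q + 1 values consisting of y and the images under f of all q elements. Those
  -- images are pairwise distinct, so the collision involves y.
  injective⇒surjective : (f : Carrier → Carrier) → (∀ {x y} → f x ≈ f y → x ≈ y) →
                         ∀ y → ∃[ x ] f x ≈ y
  injective⇒surjective f injective y with collision (y ∷ f ∘ to)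
  ... | zero  , suc j , _       , eq = to j , sym eq
  ... | suc i , suc j , s≤s i<j , eq =
    contradiction (≡.cong toℕ (to-injective (injective eq))) (ℕ.<⇒≢ i<j)

  -- Σ x = Σ (x + 1) = Σ x + q • 1, both sums over the whole field.
  order•1≈0 : q • 1# ≈ 0#
  order•1≈0 = ∙-cancelˡ (sum to) _ _ (begin
    sum to + q • 1#                    ≈⟨ +-congˡ (sum-replicate q) ⟨
    sum to + sum {q} (λ _ → 1#)        ≈⟨ ∑-distrib-+ to (λ _ → 1#) ⟨
    sum (λ i → to i + 1#)              ≈⟨ sum-cong-≋ {n = q} (λ i → sym (strictlyInverseˡ _)) ⟩
    sum (λ i → to (from (to i + 1#)))  ≈⟨ sum-permute to +1-permutation ⟨
    sum to                             ≈⟨ +-identityʳ _ ⟨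
    sum to + 0#                        ∎)
    where
    shift : Carrier → Fin q → Fin q
    shift x i = from (to i + x)

    shift-inverse : ∀ {x y} → y + x ≈ 0# → ∀ i → shift x (shift y i) ≡ i
    shift-inverse {x} {y} y+x≈0 i = ≡.trans (from-cong (begin
      to (from (to i + y)) + x  ≈⟨ +-congʳ (strictlyInverseˡ _) ⟩
      to i + y + x              ≈⟨ +-assoc _ _ _ ⟩
      to i + (y + x)            ≈⟨ +-congˡ y+x≈0 ⟩
      to i + 0#                 ≈⟨ +-identityʳ _ ⟩
      to i                      ∎)) (strictlyInverseʳ i)

    +1-permutation : Permutation q q
    +1-permutation = permutation (shift 1#) (shift (- 1#))
      (shift-inverse (-‿inverseˡ 1#)) (shift-inverse (-‿inverseʳ 1#))

-- The order of a primitive root, nonsquares, and -1 as a fourth power.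

module PrimitiveRoot {c ℓ : Level} (K : Field c ℓ) {N : ℕ} (order : HasOrder K (suc N))
    {β : Field.Carrier K} (generator : IsPrimitiveRoot K β) where

  open Field K hiding (zero)
  open FieldProperties K
  open FiniteField K order
  open Inverse order using (to)
  open import Relation.Binary.Reasoning.Setoid setoid
  open import Algebra.Properties.Semiring.Exp semiring
    using (^-congˡ; ^-congʳ; ^-homo-*; ^-assocʳ) renaming (_^_ to infixr 8 _↑_)
  open import Algebra.Properties.Ring ring using (-1*x≈-x)
  open import Algebra.Properties.Group +-group using () renaming (⁻¹-involutive to -‿involutive)

  β≉0 : ¬ (β ≈ 0#)
  β≉0 = proj₁ generator

  exponent : ∀ {x} → ¬ (x ≈ 0#) → ∃[ k ] x ≈ β ↑ k
  exponent = proj₂ generator _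

  -- A relation β^n = 1 leaves at most n nonzero elements.
  period-≥ : ∀ {n} .{{_ : NonZero n}} → β ↑ n ≈ 1# → N ℕ.≤ n
  period-≥ {n} βⁿ≈1 = ℕ.s≤s⁻¹
    (Fin.injective⇒≤ {f = residue ∘ to} λ eq → to-injective (residue-injective eq))
    where
    residue′ : ∀ x → Dec (x ≈ 0#) → Fin (suc n)
    residue′ x (yes _)   = zero
    residue′ x (no x≉0) = suc (fromℕ< (m%n<n (proj₁ (exponent x≉0)) n))

    residue : Carrier → Fin (suc n)
    residue x = residue′ x (x ≈? 0#)

    residue′-injective : ∀ {x y} x? y? → residue′ x x? ≡ residue′ y y? → x ≈ y
    residue′-injective (yes x≈0) (yes y≈0) _  = trans x≈0 (sym y≈0)
    residue′-injective {x} {y} (no x≉0) (no y≉0) eq with exponent x≉0 | exponent y≉0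
    ... | k , x≈βᵏ | l , y≈βˡ = begin
      x            ≈⟨ x≈βᵏ ⟩
      β ↑ k        ≈⟨ ^-% βⁿ≈1 k ⟨
      β ↑ (k % n)  ≡⟨ ≡.cong (β ↑_) (Fin.fromℕ<-injective _ _ _ _ (Fin.suc-injective eq)) ⟩
      β ↑ (l % n)  ≈⟨ ^-% βⁿ≈1 l ⟩
      β ↑ l        ≈⟨ y≈βˡ ⟨
      y            ∎

    residue-injective : ∀ {x y} → residue x ≡ residue y → x ≈ y
    residue-injective {x} {y} = residue′-injective (x ≈? 0#) (y ≈? 0#)

  -- Among the N + 2 values 0, β^0, ..., β^N two agree. No power of β vanishes, so the collision is
  -- between two powers and gives β^n = 1 with 0 < n ≤ N; `period-≥` then forces n = N. `NonZero N`
  -- comes along to allow division by N.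
  β^N≈1 : NonZero N × β ↑ N ≈ 1#
  β^N≈1 with collision (0# ∷ λ i → β ↑ toℕ i)
  ... | zero  , suc j , _       , eq = contradiction (sym eq) (^-nonzero (toℕ j) β≉0)
  ... | suc i , suc j , s≤s i<j , eq =
    ≡.subst (λ n → NonZero n × β ↑ n ≈ 1#) (ℕ.≤-antisym n≤N (period-≥ βⁿ≈1)) (n≢0 , βⁿ≈1)
    where
    n : ℕ
    n = toℕ j ℕ.∸ toℕ i

    instance
      n≢0 : NonZero n
      n≢0 = ℕ.>-nonZero (ℕ.m<n⇒0<n∸m i<j)

    βⁿ≈1 : β ↑ n ≈ 1#
    βⁿ≈1 = ^-cancel β≉0 (ℕ.<⇒≤ i<j) eq

    n≤N : n ℕ.≤ N
    n≤N = ℕ.≤-trans (ℕ.m∸n≤m (toℕ j) (toℕ i)) (Fin.toℕ≤pred[n] j)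

  -- The remainder of k modulo N is again an exponent at which β gives 1. It lies below N, so by
  -- `period-≥` it cannot be positive.
  period-∣ : ∀ {k} → β ↑ k ≈ 1# → N ∣ k
  period-∣ {k} βᵏ≈1 with β^N≈1
  ... | N≢0 , βᴺ≈1 = m%n≡0⇒n∣m k N {{N≢0}} remainder≡0
    where
    instance _ = N≢0

    remainder≡0 : k % N ≡ 0
    remainder≡0 with k % N in eq | m%n<n k N
    ... | zero  | _   = ≡.refl
    ... | suc r | r<N = contradiction
      (period-≥ (trans (^-congʳ β (≡.sym eq)) (trans (^-% βᴺ≈1 k) βᵏ≈1)))
      (ℕ.<⇒≱ r<N)

  module _ (8∣N : 8 ∣ N) where

    -- β^(1+2k) = β^(2m) would give β^(1 + 2(k + m(N−1))) = β^(2mN) = 1.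
    odd-power-nonsquare : ∀ k y → ¬ (β ↑ (1 ℕ.+ 2 ℕ.* k) ≈ y ↑ 2)
    odd-power-nonsquare k y eq with β^N≈1
    ... | N≢0 , βᴺ≈1 = odd-not-even (period-∣ relation)
      where
      N-1 = ℕ.pred N

      y≉0 : ¬ (y ≈ 0#)
      y≉0 y≈0 = ^-nonzero (1 ℕ.+ 2 ℕ.* k) β≉0
        (trans eq (trans (^-congˡ 2 y≈0) (zeroˡ _)))

      m = proj₁ (exponent y≉0)

      square : β ↑ (1 ℕ.+ 2 ℕ.* k) ≈ β ↑ (m ℕ.* 2)
      square = trans eq (trans (^-congˡ 2 (proj₂ (exponent y≉0))) (^-assocʳ β m 2))

      open ℕ.+-*-Solver

      exponent-sum : m ℕ.* 2 ℕ.+ m ℕ.* 2 ℕ.* N-1 ≡ m ℕ.* 2 ℕ.* N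
      exponent-sum = ≡.trans (≡.sym (ℕ.*-suc (m ℕ.* 2) N-1))
        (≡.cong (m ℕ.* 2 ℕ.*_) (ℕ.suc-pred N {{N≢0}}))

      odd : ℕ
      odd = 1 ℕ.+ 2 ℕ.* k ℕ.+ m ℕ.* 2 ℕ.* N-1

      relation : β ↑ odd ≈ 1#
      relation = begin
        β ↑ odd                                         ≈⟨ ^-homo-* β (1 ℕ.+ 2 ℕ.* k) _ ⟩
        β ↑ (1 ℕ.+ 2 ℕ.* k) * β ↑ (m ℕ.* 2 ℕ.* N-1)     ≈⟨ *-congʳ square ⟩
        β ↑ (m ℕ.* 2) * β ↑ (m ℕ.* 2 ℕ.* N-1)           ≈⟨ ^-homo-* β (m ℕ.* 2) _ ⟨
        β ↑ (m ℕ.* 2 ℕ.+ m ℕ.* 2 ℕ.* N-1)               ≡⟨ ≡.cong (β ↑_) exponent-sum ⟩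
        β ↑ (m ℕ.* 2 ℕ.* N)                             ≈⟨ ^-period βᴺ≈1 (m ℕ.* 2) ⟩
        1#                                              ∎

      odd≡ : odd ≡ 2 ℕ.* (k ℕ.+ m ℕ.* N-1) ℕ.+ 1
      odd≡ = solve 3 (λ k m n → con 1 :+ con 2 :* k :+ m :* con 2 :* n
                              := con 2 :* (k :+ m :* n) :+ con 1) ≡.refl k m N-1

      odd-not-even : ¬ (N ∣ odd)
      odd-not-even N∣odd = contradiction (∣1⇒≡1 (∣m+n∣m⇒∣n 2∣odd (m∣m*n (k ℕ.+ m ℕ.* N-1)))) λ ()
        where
        2∣odd : 2 ∣ 2 ℕ.* (k ℕ.+ m ℕ.* N-1) ℕ.+ 1
        2∣odd = ≡.subst (2 ∣_) odd≡ (∣-trans (∣-trans (divides 4 ≡.refl) 8∣N) N∣odd)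

    -- Write -1 = β^k. Squaring gives β^(2k) = 1, so N divides 2k, hence 8 divides 2k and 4 divides
    -- k.
    -1-fourth-power : ∃[ w ] w ↑ 4 ≈ - 1#
    -1-fourth-power = from-exponent (exponent -1≉0)
      where
      -1*-1≈1 : - 1# * - 1# ≈ 1#
      -1*-1≈1 = trans (-1*x≈-x (- 1#)) (-‿involutive 1#)

      -1≉0 : ¬ (- 1# ≈ 0#)
      -1≉0 = inverse-nonzero -1*-1≈1

      from-exponent : ∃[ k ] - 1# ≈ β ↑ k → ∃[ w ] w ↑ 4 ≈ - 1#
      from-exponent (k , -1≈βᵏ)
        with ∣-trans 8∣N (period-∣ {k ℕ.+ k}
               (trans (^-homo-* β k k) (trans (sym (*-cong -1≈βᵏ -1≈βᵏ)) -1*-1≈1)))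
      ... | divides j k+k≡j*8 = β ↑ j , (begin
        (β ↑ j) ↑ 4    ≈⟨ ^-assocʳ β j 4 ⟩
        β ↑ (j ℕ.* 4)  ≡⟨ ≡.cong (β ↑_) k≡j*4 ⟨
        β ↑ k          ≈⟨ -1≈βᵏ ⟨
        - 1#           ∎)
        where
        open ℕ.+-*-Solver

        k≡j*4 : k ≡ j ℕ.* 4
        k≡j*4 = ℕ.*-cancelˡ-≡ k (j ℕ.* 4) 2
          (≡.trans (solve 1 (λ k → con 2 :* k := k :+ k) ≡.refl k)
          (≡.trans k+k≡j*8 (solve 1 (λ j → j :* con 8 := con 2 :* (j :* con 4)) ≡.refl j)))

-- Nonsquares and the cosets of the fourth powers.

module FourthPowerCosets {c ℓ : Level} (K : Field c ℓ) {N : ℕ} (order : HasOrder K (suc N))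
    (8∣N : 8 ∣ N) {β : Field.Carrier K} (generator : IsPrimitiveRoot K β) where

  open Field K hiding (zero)
  open FieldProperties K
  open PrimitiveRoot K order generator
  open import Relation.Binary.Reasoning.Setoid setoid
  open import Algebra.Properties.Semiring.Exp semiring
    using (^-congˡ; ^-homo-*; ^-assocʳ) renaming (_^_ to infixr 8 _↑_)
  open import Algebra.Properties.CommutativeSemiring.Exp commutativeSemiring using (^-distrib-*)
  open import Algebra.Properties.Ring ring using (-1*x≈-x; -0#≈0#)
  open import Algebra.Properties.Group +-group using () renaming (⁻¹-involutive to -‿involutive)
  open import Algebra.Solver.Ring.NaturalCoefficients.Default commutativeSemiring

  w : Carrier
  w = proj₁ (-1-fourth-power 8∣N)

  -- Negation becomes multiplication by w⁴, which turns identities with signs into identities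
  -- between monomials.
  w⁴*x≈-x : ∀ x → w ↑ 4 * x ≈ - x
  w⁴*x≈-x x = trans (*-congʳ (proj₂ (-1-fourth-power 8∣N))) (-1*x≈-x x)

  neg-nonzero : ∀ {x} → ¬ (x ≈ 0#) → ¬ (- x ≈ 0#)
  neg-nonzero {x} x≉0 -x≈0 = x≉0 (begin
    x      ≈⟨ -‿involutive x ⟨
    - - x  ≈⟨ -‿cong -x≈0 ⟩
    - 0#   ≈⟨ -0#≈0# ⟩
    0#     ∎)

  w≉0 : ¬ (w ≈ 0#)
  w≉0 w≈0 = neg-nonzero 1≉0 (begin
    - 1#        ≈⟨ w⁴*x≈-x 1# ⟨
    w ↑ 4 * 1#  ≈⟨ *-congʳ (^-congˡ 4 w≈0) ⟩
    0# ↑ 4 * 1# ≈⟨ *-congʳ (zeroˡ _) ⟩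
    0# * 1#     ≈⟨ zeroˡ _ ⟩
    0#          ∎)

  -- If a = gz⁴ then -a = w⁴gz⁴ = gv² with v = w²z². From -a = y² it would follow that g = (y/v)²,
  -- although g is an odd power of β.
  odd-coset⇒nonsquare : ∀ k {a} → InFourthPowerCoset K (β ↑ (1 ℕ.+ 2 ℕ.* k)) a →
                        IsNonsquareUnit K (- a)
  odd-coset⇒nonsquare k {a} (z , z≉0 , a≈gz⁴) =
    neg-nonzero (λ a≈0 → *-nonzero (^-nonzero (1 ℕ.+ 2 ℕ.* k) β≉0) (^-nonzero 4 z≉0)
                           (trans (sym a≈gz⁴) a≈0)) ,
    λ (y , -a≈y²) → odd-power-nonsquare 8∣N k (y * v⁻¹) (begin
      g                             ≈⟨ *-identityʳ g ⟨
      g * 1#                        ≈⟨ *-congˡ (trans (^-congˡ 2 v*v⁻¹≈1) (1^n≈1 2)) ⟨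
      g * (v * v⁻¹) ↑ 2             ≈⟨ solve 4 (λ g w z t → g :* (w :^ 2 :* z :^ 2 :* t) :^ 2
                                          := w :^ 4 :* (g :* z :^ 4) :* t :^ 2) refl g w z v⁻¹ ⟩
      w ↑ 4 * (g * z ↑ 4) * v⁻¹ ↑ 2 ≈⟨ *-congʳ (*-congˡ a≈gz⁴) ⟨
      w ↑ 4 * a * v⁻¹ ↑ 2           ≈⟨ *-congʳ (w⁴*x≈-x a) ⟩
      - a * v⁻¹ ↑ 2                 ≈⟨ *-congʳ -a≈y² ⟩
      y ↑ 2 * v⁻¹ ↑ 2               ≈⟨ ^-distrib-* y v⁻¹ 2 ⟨
      (y * v⁻¹) ↑ 2                 ∎)
    where
    g = β ↑ (1 ℕ.+ 2 ℕ.* k)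
    v = w ↑ 2 * z ↑ 2

    v-inverse : ∃[ v⁻¹ ] v⁻¹ * v ≈ 1# × v * v⁻¹ ≈ 1#
    v-inverse = invertible v (*-nonzero (^-nonzero 2 w≉0) (^-nonzero 2 z≉0))

    v⁻¹ = proj₁ v-inverse
    v*v⁻¹≈1 = proj₂ (proj₂ v-inverse)

  -- Write a = β^k and divide k by 4, so that a = β^r (β^j)⁴ with r < 4. For even r both β^r and -1
  -- = w⁴ are squares, so -a would be a square; only r = 1 and r = 3 remain.
  nonsquare⇒odd-coset : ∀ {a} → IsNonsquareUnit K (- a) →
                        InFourthPowerCoset K β a ⊎ InFourthPowerCoset K (β ↑ 3) a
  nonsquare⇒odd-coset {a} (-a≉0 , nonsquare) with exponent a≉0
    where
    a≉0 : ¬ (a ≈ 0#)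
    a≉0 a≈0 = -a≉0 (trans (-‿cong a≈0) -0#≈0#)
  ... | k , a≈βᵏ = by-residue (k % 4) (m%n<n k 4) a≈βʳ*[βʲ]⁴
    where
    j = k / 4

    a≈βʳ*[βʲ]⁴ : a ≈ β ↑ (k % 4) * (β ↑ j) ↑ 4
    a≈βʳ*[βʲ]⁴ = begin
      a                            ≈⟨ a≈βᵏ ⟩
      β ↑ k                        ≡⟨ ≡.cong (β ↑_) (m≡m%n+[m/n]*n k 4) ⟩
      β ↑ (k % 4 ℕ.+ j ℕ.* 4)      ≈⟨ ^-homo-* β (k % 4) (j ℕ.* 4) ⟩
      β ↑ (k % 4) * β ↑ (j ℕ.* 4)  ≈⟨ *-congˡ (^-assocʳ β j 4) ⟨
      β ↑ (k % 4) * (β ↑ j) ↑ 4    ∎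

    -a-square : ∀ {x z} → a ≈ x ↑ 2 * z ↑ 4 → - a ≈ (w ↑ 2 * x * z ↑ 2) ↑ 2
    -a-square {x} {z} eq = begin
      - a                        ≈⟨ w⁴*x≈-x a ⟨
      w ↑ 4 * a                  ≈⟨ *-congˡ eq ⟩
      w ↑ 4 * (x ↑ 2 * z ↑ 4)    ≈⟨ solve 3 (λ w x z → w :^ 4 :* (x :^ 2 :* z :^ 4)
                                       := (w :^ 2 :* x :* z :^ 2) :^ 2) refl w x z ⟩
      (w ↑ 2 * x * z ↑ 2) ↑ 2    ∎

    by-residue : ∀ r → r ℕ.< 4 → a ≈ β ↑ r * (β ↑ j) ↑ 4 →
                 InFourthPowerCoset K β a ⊎ InFourthPowerCoset K (β ↑ 3) a
    -- Here β^0 = 1 is read as 1², which matches `-a-square` with x = 1; for r = 2 the choice is x =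
    -- β.
    by-residue 0 _ eq = contradiction (_ , -a-square (trans eq (*-congʳ (sym (1^n≈1 2))))) nonsquare
    by-residue 1 _ eq = inj₁ (β ↑ j , ^-nonzero j β≉0 , trans eq (*-congʳ (*-identityʳ β)))
    by-residue 2 _ eq = contradiction (_ , -a-square eq) nonsquare
    by-residue 3 _ eq = inj₂ (β ↑ j , ^-nonzero j β≉0 , eq)
    by-residue (suc (suc (suc (suc _)))) (s≤s (s≤s (s≤s (s≤s ())))) _

  nonsquare⇔odd-coset : ∀ a → IsNonsquareUnit K (- a) ⇔
                        (InFourthPowerCoset K β a ⊎ InFourthPowerCoset K (β ↑ 3) a)
  nonsquare⇔odd-coset a = mk⇔ nonsquare⇒odd-coset
    -- The power with exponent 1 + 2 · 0 unfolds to `β * 1#`, so the coset of β needs a rewriting;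
    -- the exponent 1 + 2 · 1 computes to 3.
    [ (λ (z , z≉0 , eq) → odd-coset⇒nonsquare 0 (z , z≉0 , trans eq (*-congʳ (sym (*-identityʳ β)))))
    , odd-coset⇒nonsquare 1 ]′

-- Short Weierstrass equations in characteristic 3.

module Characteristic3 {c ℓ : Level} (K : Field c ℓ) where

  open Field K hiding (zero)
  open FieldProperties K
  open import Relation.Binary.Reasoning.Setoid setoid
  open import Algebra.Properties.Semiring.Exp semiring
    using (^-congˡ) renaming (_^_ to infixr 8 _↑_)
  open import Algebra.Properties.Semiring.Mult semiring
    using (×-congʳ; ×-homo-1; ×1-homo-*; ×-assoc-*) renaming (_×_ to infixr 8 _•_)
  open import Algebra.Properties.Ring ring using (-0#≈0#)
  open import Algebra.Properties.Group +-group
    using (∙-cancelˡ; inverseˡ-unique) renaming (⁻¹-involutive to -‿involutive)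
  open import Algebra.Solver.Ring.NaturalCoefficients.Default commutativeSemiring

  3^d•1≈[3•1]^d : ∀ d → (3 ^ d) • 1# ≈ (3 • 1#) ↑ d
  3^d•1≈[3•1]^d zero    = ×-homo-1 1#
  3^d•1≈[3•1]^d (suc d) = trans (×1-homo-* 3 (3 ^ d)) (*-congˡ (3^d•1≈[3•1]^d d))

  module _ (d : ℕ) (order : HasOrder K (3 ^ d)) where

    open FiniteField K order

    -- If 3 · 1 were nonzero, so would be its d-th power, which equals 3^d · 1 and vanishes because
    -- 3^d is the order of the field.
    3•x≈0 : ∀ x → 3 • x ≈ 0#
    3•x≈0 x with 3 • 1# ≈? 0#
    ... | no 3•1≉0 = contradiction (trans (sym (3^d•1≈[3•1]^d d)) order•1≈0) (^-nonzero d 3•1≉0)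
    ... | yes 3•1≈0 = begin
      3 • x         ≈⟨ ×-congʳ 3 (*-identityˡ x) ⟨
      3 • (1# * x)  ≈⟨ ×-assoc-* 3 1# x ⟨
      3 • 1# * x    ≈⟨ *-congʳ 3•1≈0 ⟩
      0# * x        ≈⟨ zeroˡ x ⟩
      0#            ∎

    2•x≈0⇒x≈0 : ∀ {x} → 2 • x ≈ 0# → x ≈ 0#
    2•x≈0⇒x≈0 {x} 2•x≈0 = begin
      x          ≈⟨ +-identityʳ x ⟨
      x + 0#     ≈⟨ +-congˡ 2•x≈0 ⟨
      x + 2 • x  ≈⟨ 3•x≈0 x ⟩
      0#         ∎

    -- The map t ↦ t³ + at is additive in characteristic 3, so e = x - y lies in its kernel. If e ≠
    -- 0, cancelling e in e(e² + a) = 0 gives -a = e², against the hypothesis.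
    cubic-injective : ∀ {a} → IsNonsquareUnit K (- a) →
                      ∀ {x y} → x ↑ 3 + a * x ≈ y ↑ 3 + a * y → x ≈ y
    cubic-injective {a} (_ , nonsquare) {x} {y} fx≈fy with x - y ≈? 0#
    ... | yes x-y≈0 = trans (inverseˡ-unique x (- y) x-y≈0) (-‿involutive y)
    ... | no  e≉0   = contradiction (e , -a≈e²) nonsquare
      where
      e = x - y

      f : Carrier → Carrier
      f t = t ↑ 3 + a * t

      y+e≈x : y + e ≈ x
      y+e≈x = begin
        y + (x + - y)  ≈⟨ +-comm y e ⟩
        x + - y + y    ≈⟨ +-assoc x (- y) y ⟩
        x + (- y + y)  ≈⟨ +-congˡ (-‿inverseˡ y) ⟩
        x + 0#         ≈⟨ +-identityʳ x ⟩
        x              ∎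

      f-additive : f (y + e) ≈ f y + f e
      f-additive = begin
        -- The cross terms of (y + e)³ are 3ye(y + e). The nested sum ending in `con 0` is the
        -- unfolded form of that multiple.
        f (y + e)                              ≈⟨ solve 3 (λ a y e →
             (y :+ e) :^ 3 :+ a :* (y :+ e)
          := (y :^ 3 :+ a :* y) :+ (e :^ 3 :+ a :* e)
             :+ (y :* e :* (y :+ e) :+ (y :* e :* (y :+ e) :+ (y :* e :* (y :+ e) :+ con 0))))
          refl a y e ⟩
        f y + f e + 3 • (y * e * (y + e))      ≈⟨ +-congˡ (3•x≈0 _) ⟩
        f y + f e + 0#                         ≈⟨ +-identityʳ _ ⟩
        f y + f e                              ∎

      f-e≈0 : f e ≈ 0#
      f-e≈0 = ∙-cancelˡ (f y) _ _ (begin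
        f y + f e   ≈⟨ f-additive ⟨
        f (y + e)   ≈⟨ +-cong (^-congˡ 3 y+e≈x) (*-congˡ y+e≈x) ⟩
        f x         ≈⟨ fx≈fy ⟩
        f y         ≈⟨ +-identityʳ _ ⟨
        f y + 0#    ∎)

      -a≈e² : - a ≈ e ↑ 2
      -a≈e² = sym (inverseˡ-unique (e ↑ 2) a (*-cancel-0 e≉0 (trans
        (solve 2 (λ a e → e :* (e :^ 2 :+ a) := e :^ 3 :+ a :* e) refl a e) f-e≈0)))

    -- Supplies the translation of x that removes the constant term b: an injective self-map of a
    -- finite set is onto.
    cubic-root : ∀ {a} b → IsNonsquareUnit K (- a) → ∃[ r ] r ↑ 3 + a * r ≈ - b
    cubic-root b nonsquare = injective⇒surjective _ (cubic-injective nonsquare) (- b)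

    +-zero : ∀ {x x′ y} → x ≈ x′ → y ≈ 0# → x + y ≈ x′
    +-zero x≈x′ y≈0 = trans (+-cong x≈x′ y≈0) (+-identityʳ _)

    minus-zero : ∀ {x x′ y} → x ≈ x′ → y ≈ 0# → x - y ≈ x′
    minus-zero x≈x′ y≈0 = +-zero x≈x′ (trans (-‿cong y≈0) -0#≈0#)

    2•0≈0 : 2 • 0# ≈ 0#
    2•0≈0 = trans (+-identityˡ _) (+-identityˡ _)

    -- The right side of `a₄-eq` for a short source equation. The terms in a₁, a₂, a₃ vanish, 3r²
    -- vanishes by the characteristic, and 2st vanishes because s = 0.
    a₄-transform : ∀ {a r s t} → s ≈ 0# →
      a - s * 0# + 2 • (r * 0#) - (t + r * s) * 0# + 3 • (r ↑ 2) - 2 • (s * t) ≈ a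
    a₄-transform {a} {r} {s} {t} s≈0 =
      minus-zero
        (+-zero
          (minus-zero
            (+-zero (minus-zero refl (zeroʳ s)) (trans (×-congʳ 2 (zeroʳ r)) 2•0≈0))
            (zeroʳ _))
          (3•x≈0 _))
        (trans (×-congʳ 2 (trans (*-congʳ s≈0) (zeroˡ t))) 2•0≈0)

    -- The substitution is x = u²x′ + r, y = u³y′. Its constant term b + ra + r³ is zero by the
    -- choice of r.
    translate-and-scale : ∀ {a a′ b u r} → ¬ (u ≈ 0#) → u ↑ 4 * a′ ≈ a →
                          r ↑ 3 + a * r ≈ - b → Isomorphism K (short K a b) (short K a′ 0#)
    translate-and-scale {a} {a′} {b} {u} {r} u≉0 u⁴a′≈a r-root = record
      { u = u ; r = r ; s = 0# ; t = 0# ; u≉0 = u≉0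
      ; a₁-eq = trans (zeroʳ _) (sym (+-zero refl 2•0≈0))
      -- The translation creates the coefficient 3r of x², which is zero in characteristic 3.
      ; a₂-eq = trans (zeroʳ _) (sym (minus-zero
          (+-zero (minus-zero refl (zeroˡ _)) (3•x≈0 r)) (zeroˡ _)))
      ; a₃-eq = trans (zeroʳ _) (sym (+-zero (+-zero refl (zeroʳ r)) 2•0≈0))
      ; a₄-eq = trans u⁴a′≈a (sym (a₄-transform refl))
      ; a₆-eq = trans (zeroʳ _) (sym (minus-zero (minus-zero (minus-zero
          constant-term (zeroˡ _)) (zeroˡ _)) (zeroʳ _)))
      }
      where
      constant-term : b + r * a + r ↑ 2 * 0# + r ↑ 3 ≈ 0#
      constant-term = begin
        b + r * a + r ↑ 2 * 0# + r ↑ 3  ≈⟨ solve 3 (λ a b r → b :+ r :* a :+ r :^ 2 :* con 0 :+ r :^ 3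
                                              := b :+ (r :^ 3 :+ a :* r)) refl a b r ⟩
        b + (r ↑ 3 + a * r)             ≈⟨ +-congˡ r-root ⟩
        b - b                           ≈⟨ -‿inverseʳ b ⟩
        0#                              ∎

    -- Between short equations `a₁-eq` reads 0 = 2s, so s = 0 in characteristic 3, and
    -- `a₄-transform` applies.
    isomorphism⇒a₄-scaled : ∀ {a b a′ b′} (φ : Isomorphism K (short K a b) (short K a′ b′)) →
                            Isomorphism.u φ ↑ 4 * a′ ≈ a
    isomorphism⇒a₄-scaled φ = trans a₄-eq (a₄-transform s≈0)
      where
      open Isomorphism φ

      s≈0 : s ≈ 0#
      s≈0 = 2•x≈0⇒x≈0 (trans (sym (+-identityˡ _)) (trans (sym a₁-eq) (zeroʳ u)))

    -- Take u = zw with w⁴ = -1: then u⁴(-g) = gz⁴ = a. Leaving g arbitrary covers both types, g = β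
    -- and g = β³.
    coset-isomorphism : ∀ {g a b w} → ¬ (w ≈ 0#) → (∀ x → w ↑ 4 * x ≈ - x) →
                        IsNonsquareUnit K (- a) → InFourthPowerCoset K g a →
                        Isomorphism K (short K a b) (short K (- g) 0#)
    coset-isomorphism {g} {a} {b} {w} w≉0 w⁴*x≈-x nonsquare (z , z≉0 , a≈gz⁴) =
      translate-and-scale (*-nonzero z≉0 w≉0) scaled (proj₂ (cubic-root b nonsquare))
      where
      scaled : (z * w) ↑ 4 * - g ≈ a
      scaled = begin
        (z * w) ↑ 4 * - g       ≈⟨ solve 3 (λ z w h → (z :* w) :^ 4 :* h := w :^ 4 :* h :* z :^ 4) refl z w (- g) ⟩
        w ↑ 4 * - g * z ↑ 4     ≈⟨ *-congʳ (w⁴*x≈-x (- g)) ⟩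
        - - g * z ↑ 4           ≈⟨ *-congʳ (-‿involutive g) ⟩
        g * z ↑ 4               ≈⟨ a≈gz⁴ ⟨
        a                       ∎

    -- From u⁴a′ = a = gz⁴ it follows that a′ = g(z/u)⁴; the witness is zv with v the inverse of u.
    coset-invariant : ∀ {g a b a′ b′} → Isomorphism K (short K a b) (short K a′ b′) →
                      InFourthPowerCoset K g a → InFourthPowerCoset K g a′
    coset-invariant {g} {a} {b} {a′} {b′} φ (z , z≉0 , a≈gz⁴) with invertible _ (Isomorphism.u≉0 φ)
    ... | v , _ , uv≈1 = z * v , *-nonzero z≉0 (inverse-nonzero uv≈1) , (begin
      a′                        ≈⟨ *-identityˡ a′ ⟨
      1# * a′                   ≈⟨ *-congʳ (trans (^-congˡ 4 uv≈1) (1^n≈1 4)) ⟨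
      (u * v) ↑ 4 * a′          ≈⟨ solve 3 (λ u v a → (u :* v) :^ 4 :* a := u :^ 4 :* a :* v :^ 4) refl u v a′ ⟩
      u ↑ 4 * a′ * v ↑ 4        ≈⟨ *-congʳ (trans (isomorphism⇒a₄-scaled φ) a≈gz⁴) ⟩
      g * z ↑ 4 * v ↑ 4         ≈⟨ solve 3 (λ g z v → g :* z :^ 4 :* v :^ 4 := g :* (z :* v) :^ 4) refl g z v ⟩
      g * (z * v) ↑ 4           ∎)
      where u = Isomorphism.u φ

-- The field order modulo 8, and assembly of the theorem.

-- Holds since 3² = 9 is 1 modulo 8. The number N is q - 1, the order of the multiplicative group.
9^m≡1+8c : ∀ m → ∃[ N ] 3 ^ (m ℕ.* 2) ≡ suc N × 8 ∣ N
9^m≡1+8c zero = 0 , ≡.refl , divides 0 ≡.refl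
9^m≡1+8c (suc m) with 9^m≡1+8c m
... | .(c ℕ.* 8) , eq , divides c ≡.refl =
  -- The witness comes from 9(1 + 8c) = 1 + 8(9c + 1).
  (9 ℕ.* c ℕ.+ 1) ℕ.* 8 ,
  ≡.trans (≡.cong (λ n → 3 ℕ.* (3 ℕ.* n)) eq)
    (solve 1 (λ c → con 3 :* (con 3 :* (con 1 :+ c :* con 8))
                 := con 1 :+ (con 9 :* c :+ con 1) :* con 8) ≡.refl c) ,
  divides (9 ℕ.* c ℕ.+ 1) ≡.refl
  where open ℕ.+-*-Solver

mainTheorem4 : ∀ {c ℓ : Level} (d : ℕ) → 2 ∣ d →
    (K : Field c ℓ) → HasOrder K (3 ^ d) →
    let open Field K in
    (β : Carrier) → IsPrimitiveRoot K β →
    (a₄ a₆ : Carrier) → IsElliptic K (short K a₄ a₆) →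
    (IsNonsquareUnit K (- a₄) ⇔ (TypeIIIa K β a₄ ⊎ TypeIIIb K β a₄))
    × (IsNonsquareUnit K (- a₄) →
    (TypeIIIa K β a₄ →
    Isomorphism K (short K a₄ a₆) (short K (- β) 0#)
    × (∀ (a₄′ a₆′ : Carrier) → IsElliptic K (short K a₄′ a₆′) →
    Isomorphism K (short K a₄ a₆) (short K a₄′ a₆′) →
    TypeIIIa K β a₄′))
    × (TypeIIIb K β a₄ →
    Isomorphism K (short K a₄ a₆) (short K (- power semiring β 3) 0#)))
mainTheorem4 d (divides m ≡.refl) K order β generator a₄ a₆ _ with 9^m≡1+8c m
... | N , 3^d≡1+N , 8∣N =
  nonsquare⇔odd-coset a₄ ,
  λ nonsquare →
    (λ IIIa → coset-isomorphism (m ℕ.* 2) order w≉0 w⁴*x≈-x nonsquare IIIa ,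
              λ _ _ _ φ → coset-invariant (m ℕ.* 2) order φ IIIa) ,
    coset-isomorphism (m ℕ.* 2) order w≉0 w⁴*x≈-x nonsquare
  where
  -- The coset argument takes the order in the form 1 + N, the characteristic 3 argument in the form
  -- of a power of 3; hence the transport of `order` here only.
  open FourthPowerCosets K (≡.subst (HasOrder K) 3^d≡1+N order) 8∣N generator
  open Characteristic3 K
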